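{- For every ground PCF$_{\mathtt P}$ term $P \colon D\mathtt{int} \to D\mathtt{int} \to D\mathtt{int}$, one has $\Pr[\mathtt{portest}\;P \downarrow 0] \leq 8/27$. Moreover this bound is attained by taking $P$ to be $\mathtt{pmpor}$, i.e. $\Pr[\mathtt{portest}\;\mathtt{pmpor} \downarrow 0] = 8/27$.
   Context: **Syntax of PCF$_{\mathtt P}$.** Types are given by $\sigma,\tau ::= \mathtt{int} \mid D\tau \mid \sigma\to\tau$ (with $\to$ associating to the right). Computation types are the types of the form $D\tau$, or $\sigma\to\tau$ with $\tau$ a computation type. For each type $\tau$ there is a countably infinite set of variables $x_\tau$ of type $\tau$; each variable has a unique type. Terms $M\colon\tau$ ("$M$ is a term of type $\tau$") are defined inductively: variables $x_\tau\colon\tau$; constants $n\colon\mathtt{int}$ for $n\in\mathbb Z$; $\mathtt s M\colon\mathtt{int}$ and $\mathtt p M\colon\mathtt{int}$ if $M\colon\mathtt{int}$; $\mathtt{if}\ M=0\ \mathtt{then}\ N\ \mathtt{else}\ P\colon\tau$ if $M\colon\mathtt{int}$ and $N,P\colon\tau$; $\mathtt{rec}_\tau M\colon\tau$ if $M\colon\tau\to\tau$ and $\tau$ is a computation type; $MN\colon\tau$ if $M\colon\sigma\to\tau$, $N\colon\sigma$; $\lambda x_\sigma.M\colon\sigma\to\tau$ if $M\colon\tau$; $M\oplus N\colon D\tau$ if $M,N\colon D\tau$; $\mathtt{ret}_\sigma M\colon D\sigma$ if $M\colon\sigma$; $\mathtt{bind}_{\sigma,\tau}MN\colon D\tau$ if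 $M\colon D\sigma$, $N\colon\sigma\to D\tau$. Substitution is capture-avoiding; terms are taken up to renaming of bound variables. A term is ground if it has no free variable. Application associates to the left. $\mathtt{do}\ x_\sigma\leftarrow M;N$ abbreviates $\mathtt{bind}_{\sigma,\tau}M(\lambda x_\sigma.N)$. **Operational semantics.** Elementary contexts $E$, with their types: $[\_\,N]$ of type $(\sigma\to\tau)\vdash\tau$ for $N\colon\sigma$; $[\mathtt s\,\_]$ and $[\mathtt p\,\_]$ of type $\mathtt{int}\vdash\mathtt{int}$; $[\mathtt{if}\ \_=0\ \mathtt{then}\ N\ \mathtt{else}\ P]$ of type $\mathtt{int}\vdash\tau$ for $N,P\colon\tau$; $[\mathtt{bind}_{\sigma,\tau}\,\_\,N]$ of type $D\sigma\vdash D\tau$ for $N\colon\sigma\to D\tau$. Initial contexts: $[\_]$ of type $\sigma\vdash\sigma$ (any $\sigma$), and $[\mathtt{ret}_{\mathtt{int}}\,\_]$ of type $\mathtt{int}\vdash D\mathtt{int}$. A context $C$ of type $\sigma_{n+1}\vdash\sigma_0$ is a finite sequence $E_0E_1\cdots E_n$ ($n\ge 0$) where $E_0$ is an initial context of type $\sigma_1\vdash\sigma_0$ and each $E_i$ ($1\le i\le n$) is an elementary context of type $\sigma_{i+1}\vdash\sigma_i$. $E[M]$ is obtained by replacing the hole $\_$ by $M$ (and removing the square brackets). $CE$ is $C$ with $E$ appended. A configuration of type $\tau$ is a pair $C\cdot M$ with $C$ a context of type $\sigma\vdash\tau$ and $M\colon\sigma$. The probabilistic transitions $s\xrightarrow{\alpha}s'$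 are: - exploration rules: $C\cdot E[M]\xrightarrow{1}CE\cdot M$ ($E$ elementary); $[\_]\cdot\mathtt{ret}_{\mathtt{int}}M\xrightarrow{1}[\mathtt{ret}_{\mathtt{int}}\,\_]\cdot M$; - computation rules: $C[\_\,N]\cdot\lambda x_\sigma.M\xrightarrow{1}C\cdot M[x_\sigma:=N]$; $C\cdot\mathtt{rec}_\tau M\xrightarrow{1}C\cdot M(\mathtt{rec}_\tau M)$; $C\cdot M\oplus N\xrightarrow{1/2}C\cdot M$; $C\cdot M\oplus N\xrightarrow{1/2}C\cdot N$ (these are two distinct transitions, even if $M=N$); $C[\mathtt{bind}_{\sigma,\tau}\,\_\,N]\cdot\mathtt{ret}_\sigma M\xrightarrow{1}C\cdot NM$; $C[\mathtt p\,\_]\cdot n\xrightarrow{1}C\cdot n-1$; $C[\mathtt s\,\_]\cdot n\xrightarrow{1}C\cdot n+1$; $C[\mathtt{if}\ \_=0\ \mathtt{then}\ N\ \mathtt{else}\ P]\cdot 0\xrightarrow{1}C\cdot N$; $C[\mathtt{if}\ \_=0\ \mathtt{then}\ N\ \mathtt{else}\ P]\cdot n\xrightarrow{1}C\cdot P$ for $n\ne0$. A trace from $s_0$ to $s_m$ is a finite sequence of transitions $s_0\xrightarrow{\alpha_1}s_1\cdots\xrightarrow{\alpha_m}s_m$ ($m\ge0$); its weight is $\alpha_1\cdots\alpha_m$. For a configuration $s$ of type $D\mathtt{int}$ and $n\in\mathbb Z$, $\Pr[s\downarrow n]$ is the sum of the weights of all traces starting at $s$ and ending at $[\mathtt{ret}_{\mathtt{int}}\,\_]\cdot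 n$. For $M\colon D\mathtt{int}$, $\Pr[M\downarrow n]$ means $\Pr[[\_]\cdot M\downarrow n]$. **Particular terms.** $\Omega:=\mathtt{rec}_{D\mathtt{int}}(\lambda a_{D\mathtt{int}}.a_{D\mathtt{int}})$. $\mathtt{portest}:=\lambda f_{D\mathtt{int}\to D\mathtt{int}\to D\mathtt{int}}.\ \mathtt{do}\ x_{\mathtt{int}}\leftarrow f(\mathtt{ret}_{\mathtt{int}}1)(\mathtt{ret}_{\mathtt{int}}1);\ \mathtt{if}\ x=0\ \mathtt{then}\ \Omega\ \mathtt{else}\ (\mathtt{do}\ y_{\mathtt{int}}\leftarrow f(\mathtt{ret}_{\mathtt{int}}0)(\Omega);\ \mathtt{if}\ y=0\ \mathtt{then}\ (\mathtt{do}\ z_{\mathtt{int}}\leftarrow f(\Omega)(\mathtt{ret}_{\mathtt{int}}0);\ \mathtt{if}\ z=0\ \mathtt{then}\ \mathtt{ret}_{\mathtt{int}}0\ \mathtt{else}\ \Omega)\ \mathtt{else}\ \Omega)$. $\mathtt{lror}:=\lambda p_{D\mathtt{int}}.\lambda q_{D\mathtt{int}}.\ \mathtt{do}\ x_{\mathtt{int}}\leftarrow p;\ \mathtt{if}\ x=0\ \mathtt{then}\ \mathtt{ret}_{\mathtt{int}}0\ \mathtt{else}\ q$. $\mathtt{rlor}:=\lambda p_{D\mathtt{int}}.\lambda q_{D\mathtt{int}}.\ \mathtt{do}\ x_{\mathtt{int}}\leftarrow q;\ \mathtt{if}\ x=0\ \mathtt{then}\ \mathtt{ret}_{\mathtt{int}}0\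 \mathtt{else}\ p$. $\mathtt{pmpor}:=\lambda p_{D\mathtt{int}}.\lambda q_{D\mathtt{int}}.\ \mathtt{rec}_{D\mathtt{int}}(\lambda r_{D\mathtt{int}}.\ ((\mathtt{lror}\;p\;q)\oplus(\mathtt{rlor}\;p\;q))\oplus(\mathtt{ret}_{\mathtt{int}}0\oplus r))$. -}

module Defs where

open import Data.Integer as ℤ using (ℤ; 0ℤ; 1ℤ)
open import Data.List using (List; []; _∷_; map; foldr)
open import Data.List.Relation.Unary.Unique.Propositional using (Unique)
open import Data.Product using (_×_; ∃-syntax)
open import Data.Rational using (ℚ; 0ℚ; 1ℚ; ½; _+_; _*_; _<_)
open import Level using (0ℓ)
open import Relation.Binary.PropositionalEquality using (_≢_)
open import Relation.Unary using (Pred; _⊆_; _≐_)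

------------------------------------------------------------------------
-- Terms
--
-- Terms are intrinsically typed, with typed de Bruijn indices in place
-- of named variables, so that α-equivalent terms are equal.

infixr 7 _⇒_

data Type : Set where
  int : Type
  D   : Type → Type
  _⇒_ : Type → Type → Type

data Computation : Type → Set where
  D   : ∀ {τ} → Computation (D τ)
  _⇒_ : ∀ σ {τ} → Computation τ → Computation (σ ⇒ τ)

Scope : Set
Scope = List Type

infix 4 _∋_

data _∋_ : Scope → Type → Set where
  here  : ∀ {Γ τ} → τ ∷ Γ ∋ τ
  there : ∀ {Γ σ τ} → Γ ∋ τ → σ ∷ Γ ∋ τ

infixl 7 _$_
infixl 6 _⊕_
infixr 5 ƛ_ Do_⨾_
infix  5 if_=0then_else_

data Term (Γ : Scope) : Type → Set where
  var             : ∀ {τ} → Γ ∋ τ → Term Γ τ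
  con             : ℤ → Term Γ int
  s p             : Term Γ int → Term Γ int
  if_=0then_else_ : ∀ {τ} → Term Γ int → Term Γ τ → Term Γ τ → Term Γ τ
  rec             : ∀ {τ} → Computation τ → Term Γ (τ ⇒ τ) → Term Γ τ
  _$_             : ∀ {σ τ} → Term Γ (σ ⇒ τ) → Term Γ σ → Term Γ τ
  ƛ_              : ∀ {σ τ} → Term (σ ∷ Γ) τ → Term Γ (σ ⇒ τ)
  _⊕_             : ∀ {τ} → Term Γ (D τ) → Term Γ (D τ) → Term Γ (D τ)
  ret             : ∀ {σ} → Term Γ σ → Term Γ (D σ)
  bind            : ∀ {σ τ} → Term Γ (D σ) → Term Γ (σ ⇒ D τ) → Term Γ (D τ)

Ground : Type → Set
Ground τ = Term [] τ

-- do x ← M; N, where index 0 of N is x.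
Do_⨾_ : ∀ {Γ σ τ} → Term Γ (D σ) → Term (σ ∷ Γ) (D τ) → Term Γ (D τ)
Do M ⨾ N = bind M (ƛ N)

------------------------------------------------------------------------
-- Substitution

Renaming : Scope → Scope → Set
Renaming Γ Δ = ∀ {τ} → Γ ∋ τ → Δ ∋ τ

Substitution : Scope → Scope → Set
Substitution Γ Δ = ∀ {τ} → Γ ∋ τ → Term Δ τ

liftᵣ : ∀ {Γ Δ σ} → Renaming Γ Δ → Renaming (σ ∷ Γ) (σ ∷ Δ)
liftᵣ ρ here      = here
liftᵣ ρ (there x) = there (ρ x)

rename : ∀ {Γ Δ τ} → Renaming Γ Δ → Term Γ τ → Term Δ τ
rename ρ (var x)                = var (ρ x)
rename ρ (con n)                = con n
rename ρ (s M)                  = s (rename ρ M)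
rename ρ (p M)                  = p (rename ρ M)
rename ρ (if M =0then N else P) =
  if rename ρ M =0then rename ρ N else rename ρ P
rename ρ (rec c M)              = rec c (rename ρ M)
rename ρ (M $ N)                = rename ρ M $ rename ρ N
rename ρ (ƛ M)                  = ƛ rename (liftᵣ ρ) M
rename ρ (M ⊕ N)                = rename ρ M ⊕ rename ρ N
rename ρ (ret M)                = ret (rename ρ M)
rename ρ (bind M N)             = bind (rename ρ M) (rename ρ N)

liftₛ : ∀ {Γ Δ σ} → Substitution Γ Δ → Substitution (σ ∷ Γ) (σ ∷ Δ)
liftₛ θ here      = var here
liftₛ θ (there x) = rename there (θ x)

subst : ∀ {Γ Δ τ} → Substitution Γ Δ → Term Γ τ → Term Δ τ
subst θ (var x)                = θ x
subst θ (con n)                = con n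
subst θ (s M)                  = s (subst θ M)
subst θ (p M)                  = p (subst θ M)
subst θ (if M =0then N else P) =
  if subst θ M =0then subst θ N else subst θ P
subst θ (rec c M)              = rec c (subst θ M)
subst θ (M $ N)                = subst θ M $ subst θ N
subst θ (ƛ M)                  = ƛ subst (liftₛ θ) M
subst θ (M ⊕ N)                = subst θ M ⊕ subst θ N
subst θ (ret M)                = ret (subst θ M)
subst θ (bind M N)             = bind (subst θ M) (subst θ N)

single : ∀ {Γ σ} → Term Γ σ → Substitution (σ ∷ Γ) Γ
single N here      = N
single N (there x) = var x

infix 8 _[0:=_]

_[0:=_] : ∀ {Γ σ τ} → Term (σ ∷ Γ) τ → Term Γ σ → Term Γ τ
M [0:= N ] = subst (single N) M

------------------------------------------------------------------------
-- Operational semantics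

-- Elementary Γ σ τ and Context Γ σ τ are the (elementary) contexts of
-- type σ ⊢ τ.
data Elementary (Γ : Scope) : Type → Type → Set where
  -$_             : ∀ {σ τ} → Term Γ σ → Elementary Γ (σ ⇒ τ) τ
  s- p-           : Elementary Γ int int
  if-=0then_else_ : ∀ {τ} → Term Γ τ → Term Γ τ → Elementary Γ int τ
  bind-           : ∀ {σ τ} → Term Γ (σ ⇒ D τ) → Elementary Γ (D σ) (D τ)

infixl 5 _▹_

-- The first two constructors are the initial contexts; _▹_ appends an
-- elementary context at the inner end.
data Context (Γ : Scope) : Type → Type → Set where
  □    : ∀ {σ} → Context Γ σ σ
  ret□ : Context Γ int (D int)
  _▹_  : ∀ {ρ σ τ} → Context Γ σ τ → Elementary Γ ρ σ → Context Γ ρ τ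

infix 4 _∙_

data Configuration (Γ : Scope) (τ : Type) : Set where
  _∙_ : ∀ {σ} → Context Γ σ τ → Term Γ σ → Configuration Γ τ

infix 3 _⟶[_]_

-- The rule C · E[M] → CE · M is unfolded into one constructor for each
-- form of E.  The hypothesis of if≢0 is irrelevant so that it does not
-- multiply the number of transitions.
data _⟶[_]_ {Γ : Scope} :
  ∀ {τ} → Configuration Γ τ → ℚ → Configuration Γ τ → Set where

  explore-$ : ∀ {σ τ υ} {C : Context Γ τ υ} {M : Term Γ (σ ⇒ τ)} {N} →
    C ∙ M $ N ⟶[ 1ℚ ] C ▹ -$ N ∙ M
  explore-s : ∀ {υ} {C : Context Γ int υ} {M} →
    C ∙ s M ⟶[ 1ℚ ] C ▹ s- ∙ M
  explore-p : ∀ {υ} {C : Context Γ int υ} {M} →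
    C ∙ p M ⟶[ 1ℚ ] C ▹ p- ∙ M
  explore-if : ∀ {τ υ} {C : Context Γ τ υ} {M N P} →
    C ∙ (if M =0then N else P) ⟶[ 1ℚ ] C ▹ (if-=0then N else P) ∙ M
  explore-bind : ∀ {σ τ υ} {C : Context Γ (D τ) υ} {M : Term Γ (D σ)} {N} →
    C ∙ bind M N ⟶[ 1ℚ ] C ▹ bind- N ∙ M
  explore-ret : ∀ {M : Term Γ int} →
    □ ∙ ret M ⟶[ 1ℚ ] ret□ ∙ M

  β : ∀ {σ τ υ} {C : Context Γ τ υ} {M : Term (σ ∷ Γ) τ} {N} →
    C ▹ -$ N ∙ ƛ M ⟶[ 1ℚ ] C ∙ M [0:= N ]
  unfold : ∀ {τ υ} {C : Context Γ τ υ} {c : Computation τ} {M} →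
    C ∙ rec c M ⟶[ 1ℚ ] C ∙ M $ rec c M
  ⊕-left : ∀ {τ υ} {C : Context Γ (D τ) υ} {M N} →
    C ∙ M ⊕ N ⟶[ ½ ] C ∙ M
  ⊕-right : ∀ {τ υ} {C : Context Γ (D τ) υ} {M N} →
    C ∙ M ⊕ N ⟶[ ½ ] C ∙ N
  bind-ret : ∀ {σ τ υ} {C : Context Γ (D τ) υ} {M : Term Γ σ} {N} →
    C ▹ bind- N ∙ ret M ⟶[ 1ℚ ] C ∙ N $ M
  pred : ∀ {υ} {C : Context Γ int υ} {n} →
    C ▹ p- ∙ con n ⟶[ 1ℚ ] C ∙ con (n ℤ.- 1ℤ)
  succ : ∀ {υ} {C : Context Γ int υ} {n} →
    C ▹ s- ∙ con n ⟶[ 1ℚ ] C ∙ con (n ℤ.+ 1ℤ)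
  if≡0 : ∀ {τ υ} {C : Context Γ τ υ} {N P} →
    C ▹ (if-=0then N else P) ∙ con 0ℤ ⟶[ 1ℚ ] C ∙ N
  if≢0 : ∀ {τ υ} {C : Context Γ τ υ} {N P n} → .(n ≢ 0ℤ) →
    C ▹ (if-=0then N else P) ∙ con n ⟶[ 1ℚ ] C ∙ P

data Trace {Γ : Scope} {τ : Type} :
  Configuration Γ τ → Configuration Γ τ → Set where
  []  : ∀ {c} → Trace c c
  _∷_ : ∀ {c₁ c₂ c₃ α} → c₁ ⟶[ α ] c₂ → Trace c₂ c₃ → Trace c₁ c₃

weight : ∀ {Γ τ} {c d : Configuration Γ τ} → Trace c d → ℚ
weight []                = 1ℚ
weight (_∷_ {α = α} _ t) = α * weight t

totalWeight : ∀ {Γ τ} {c d : Configuration Γ τ} → List (Trace c d) → ℚ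
totalWeight ts = foldr _+_ 0ℚ (map weight ts)

------------------------------------------------------------------------
-- Probabilities
--
-- A sum of infinitely many non-negative rationals is the supremum of its
-- finite subsums.  Such an extended real r is represented by its lower
-- cut, the set of rationals q < r; the order is then inclusion of cuts.

LowerReal : Set₁
LowerReal = Pred ℚ 0ℓ

infix 4 _≤ᴸ_ _≡ᴸ_

_≤ᴸ_ _≡ᴸ_ : LowerReal → LowerReal → Set
x ≤ᴸ y = x ⊆ y
x ≡ᴸ y = x ≐ y

⌜_⌝ : ℚ → LowerReal
⌜ r ⌝ q = q < r

Pr⟨_↓_⟩ : ∀ {Γ} → Configuration Γ (D int) → ℤ → LowerReal
Pr⟨ c ↓ n ⟩ q =
  ∃[ ts ] Unique ts × q < totalWeight {c = c} {d = ret□ ∙ con n} ts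

Pr[_↓_] : ∀ {Γ} → Term Γ (D int) → ℤ → LowerReal
Pr[ M ↓ n ] = Pr⟨ □ ∙ M ↓ n ⟩

------------------------------------------------------------------------
-- Particular terms

Ω : ∀ {Γ} → Term Γ (D int)
Ω = rec D (ƛ var here)

portest : ∀ {Γ} → Term Γ ((D int ⇒ D int ⇒ D int) ⇒ D int)
portest =
  ƛ Do var here $ ret (con 1ℤ) $ ret (con 1ℤ) ⨾
    if var here =0then Ω else
    (Do var (there here) $ ret (con 0ℤ) $ Ω ⨾
      if var here =0then
        (Do var (there (there here)) $ Ω $ ret (con 0ℤ) ⨾
          if var here =0then ret (con 0ℤ) else Ω)
      else Ω)

lror : ∀ {Γ} → Term Γ (D int ⇒ D int ⇒ D int)
lror = ƛ ƛ Do var (there here) ⨾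
  if var here =0then ret (con 0ℤ) else var (there here)

rlor : ∀ {Γ} → Term Γ (D int ⇒ D int ⇒ D int)
rlor = ƛ ƛ Do var here ⨾
  if var here =0then ret (con 0ℤ) else var (there (there here))

pmpor : ∀ {Γ} → Term Γ (D int ⇒ D int ⇒ D int)
pmpor = ƛ ƛ rec D (ƛ
  (((lror $ x $ y) ⊕ (rlor $ x $ y)) ⊕ (ret (con 0ℤ) ⊕ var here)))
  where
  x y : ∀ {Γ ρ} → Term (ρ ∷ D int ∷ D int ∷ Γ) (D int)
  x = var (there (there here))
  y = var (there here)

{-# OPTIONS --safe #-}

-- Let a, b and c be the probabilities that P (ret 1) (ret 1) returns a
-- nonzero number, that P (ret 0) Ω returns 0 and that P Ω (ret 0)
-- returns 0.  The test portest P succeeds with probability a b c.  Run P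
-- on two free variables x and y instead: each sequence of coin flips
-- either returns a fixed number, which contributes to a or to b and c
-- but not to both, or first calls x, which makes the call with x = Ω
-- diverge, or first calls y, which makes the call with y = Ω diverge.
-- Hence a + b + c ≤ 2, and a b c ≤ 8/27 by the inequality of arithmetic
-- and geometric means.  For pmpor, n unfoldings of its loop give
-- a, b, c ≥ (2/3) (1 - 4⁻ⁿ).

module Submission where

open import Defs
open import Data.Empty using (⊥-elim; ⊥-elim-irr)
open import Data.Integer as ℤ using (ℤ; +_; -[1+_]; 0ℤ; 1ℤ)
import Data.Integer.Properties as ℤ
open import Data.List using (List; []; _∷_; _++_; map)
open import Data.List.Membership.Propositional.Properties using (∈-map⁻)
open import Data.List.Relation.Binary.Disjoint.Propositional using (Disjoint)
open import Data.List.Relation.Binary.Permutation.Propositional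
  using (_↭_; refl; prep; ↭-trans; ↭-sym; ↭⇒↭ₛ)
open import Data.List.Relation.Binary.Permutation.Propositional.Properties
  using (shift; map⁺; All-resp-↭)
import Data.List.Relation.Binary.Permutation.Setoid.Properties as Permutation
open import Data.List.Relation.Unary.All as All using (All; []; _∷_)
import Data.List.Relation.Unary.All.Properties as All
open import Data.List.Relation.Unary.AllPairs using ([]; _∷_)
open import Data.List.Relation.Unary.Unique.Propositional using (Unique)
import Data.List.Relation.Unary.Unique.Propositional.Properties as Unique
open import Data.Nat as ℕ using (ℕ; zero; suc)
import Data.Nat.Properties as ℕ
open import Data.Product using (_×_; _,_; ∃-syntax; ∃₂; proj₁; proj₂)
open import Data.Rational
  using (ℚ; 0ℚ; 1ℚ; ½; _+_; _*_; _-_; -_; _≤_; _<_; _/_; mkℚ; *<*; nonNegative; toℚᵘ)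
open import Data.Rational.Properties
open import Data.Rational.Solver using (module +-*-Solver)
open import Data.Rational.Unnormalised as ℚᵘ using (mkℚᵘ; *≡*; *≤*)
import Data.Rational.Unnormalised.Properties as ℚᵘ
open import Data.Sum using (_⊎_; inj₁; inj₂)
open import Function using (_∘_)
open import Relation.Binary.PropositionalEquality as ≡
  using (_≡_; _≢_; refl; sym; cong; cong₂)
open +-*-Solver using (solve; con; _:+_; _:*_; _:-_; _:=_)

-- Arithmetic of rational numbers

0≤* : ∀ {x y} → 0ℚ ≤ x → 0ℚ ≤ y → 0ℚ ≤ x * y
0≤* {x} {y} 0≤x 0≤y = nonNegative⁻¹ (x * y)
  {{nonNeg*nonNeg⇒nonNeg x {{nonNegative 0≤x}} y {{nonNegative 0≤y}}}}

0≤+ : ∀ {x y} → 0ℚ ≤ x → 0ℚ ≤ y → 0ℚ ≤ x + y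
0≤+ = +-mono-≤

*-mono-≤ : ∀ {x x′ y y′} → 0ℚ ≤ y → 0ℚ ≤ x′ → x ≤ x′ → y ≤ y′ → x * y ≤ x′ * y′
*-mono-≤ {x′ = x′} {y} 0≤y 0≤x′ x≤x′ y≤y′ = ≤-trans
  (*-monoʳ-≤-nonNeg y {{nonNegative 0≤y}} x≤x′)
  (*-monoˡ-≤-nonNeg x′ {{nonNegative 0≤x′}} y≤y′)

mean : ℚ → ℚ → ℚ
mean x y = ½ * x + ½ * y

mean-mono : ∀ {x x′ y y′} → x ≤ x′ → y ≤ y′ → mean x y ≤ mean x′ y′
mean-mono x≤x′ y≤y′ =
  +-mono-≤ (*-monoˡ-≤-nonNeg ½ x≤x′) (*-monoˡ-≤-nonNeg ½ y≤y′)

mean-*ʳ : ∀ x y w → mean (x * w) (y * w) ≡ mean x y * w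
mean-*ʳ = solve 3 (λ x y w → con ½ :* (x :* w) :+ con ½ :* (y :* w) :=
                             (con ½ :* x :+ con ½ :* y) :* w) refl

+³-mono-≤ : ∀ {x y z x′ y′ z′} → x ≤ x′ → y ≤ y′ → z ≤ z′ →
  x + y + z ≤ x′ + y′ + z′
+³-mono-≤ x≤ y≤ z≤ = +-mono-≤ (+-mono-≤ x≤ y≤) z≤

mean-+³ : ∀ x x′ y y′ z z′ →
  mean x x′ + mean y y′ + mean z z′ ≡ mean (x + y + z) (x′ + y′ + z′)
mean-+³ = solve 6 (λ x x′ y y′ z z′ →
  (con ½ :* x :+ con ½ :* x′) :+ (con ½ :* y :+ con ½ :* y′)
    :+ (con ½ :* z :+ con ½ :* z′) :=
  con ½ :* (x :+ y :+ z) :+ con ½ :* (x′ :+ y′ :+ z′)) refl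

1≤2 : 1ℚ ≤ 1ℚ + 1ℚ
1≤2 = +-mono-≤ {1ℚ} {1ℚ} {0ℚ} {1ℚ} ≤-refl (nonNegative⁻¹ 1ℚ)

p≤q⇒0≤q-p : ∀ {x y} → x ≤ y → 0ℚ ≤ y - x
p≤q⇒0≤q-p {x} {y} x≤y = ≡.subst (_≤ y - x) (+-inverseʳ x) (+-monoˡ-≤ (- x) x≤y)

p<q⇒0<q-p : ∀ {x y} → x < y → 0ℚ < y - x
p<q⇒0<q-p {x} {y} x<y = ≡.subst (_< y - x) (+-inverseʳ x) (+-monoˡ-< (- x) x<y)

0≤square : ∀ x → 0ℚ ≤ x * x
0≤square x with ≤-total 0ℚ x
... | inj₁ 0≤x = 0≤* 0≤x 0≤x
... | inj₂ x≤0 = ≡.subst (0ℚ ≤_)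
  (solve 1 (λ x → (con 0ℚ :- x) :* (con 0ℚ :- x) := x :* x) refl x)
  (0≤* (p≤q⇒0≤q-p x≤0) (p≤q⇒0≤q-p x≤0))

p≤p+nonNeg : ∀ {x y} → 0ℚ ≤ y → x ≤ x + y
p≤p+nonNeg {x} {y} 0≤y = ≡.subst (_≤ x + y) (+-identityʳ x) (+-monoʳ-≤ x 0≤y)

-- The two sides differ by `gap / 27`, whose summands are all nonnegative. The trailing factor `1ℚ`
-- matches the nested product in `eval-portest`.
am-gm : ∀ {a b c} → 0ℚ ≤ a → 0ℚ ≤ b → 0ℚ ≤ c →
  a * (b * (c * 1ℚ)) ≤ + 1 / 27 * ((a + b + c) * ((a + b + c) * (a + b + c)))
am-gm {a} {b} {c} 0≤a 0≤b 0≤c = begin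
  a * (b * (c * 1ℚ)) ≤⟨ p≤p+nonNeg (0≤* {+ 1 / 27} (nonNegative⁻¹ _) 0≤gap) ⟩
  a * (b * (c * 1ℚ)) + + 1 / 27 * gap
    ≡⟨ solve 3 (λ a b c → a :* (b :* (c :* con 1ℚ)) :+ con (+ 1 / 27) :* (
         con ½ :* ((a :+ b :+ c) :* ((a :- b) :* (a :- b) :+ (b :- c) :* (b :- c) :+ (c :- a) :* (c :- a)))
         :+ con (+ 3 / 1) :* (a :* ((b :- c) :* (b :- c)) :+ b :* ((c :- a) :* (c :- a)) :+ c :* ((a :- b) :* (a :- b))))
         := con (+ 1 / 27) :* ((a :+ b :+ c) :* ((a :+ b :+ c) :* (a :+ b :+ c)))) refl a b c ⟩
  + 1 / 27 * ((a + b + c) * ((a + b + c) * (a + b + c))) ∎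
  where
  open ≤-Reasoning
  -- (a + b + c)³ − 27 a b c as a combination of squares.
  gap : ℚ
  gap = ½ * ((a + b + c) * ((a - b) * (a - b) + (b - c) * (b - c) + (c - a) * (c - a)))
      + + 3 / 1 * (a * ((b - c) * (b - c)) + b * ((c - a) * (c - a)) + c * ((a - b) * (a - b)))
  0≤gap : 0ℚ ≤ gap
  0≤gap = 0≤+
    (0≤* {½} (nonNegative⁻¹ ½) (0≤* (0≤+ (0≤+ 0≤a 0≤b) 0≤c)
      (0≤+ (0≤+ (0≤square (a - b)) (0≤square (b - c))) (0≤square (c - a)))))
    (0≤* {+ 3 / 1} (nonNegative⁻¹ _)
      (0≤+ (0≤+ (0≤* 0≤a (0≤square (b - c))) (0≤* 0≤b (0≤square (c - a)))) (0≤* 0≤c (0≤square (a - b)))))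

product≤8/27 : ∀ {a b c} → 0ℚ ≤ a → 0ℚ ≤ b → 0ℚ ≤ c → a + b + c ≤ 1ℚ + 1ℚ →
  a * (b * (c * 1ℚ)) ≤ + 8 / 27
product≤8/27 {a} {b} {c} 0≤a 0≤b 0≤c sum≤2 = ≤-trans (am-gm 0≤a 0≤b 0≤c)
  (*-monoˡ-≤-nonNeg (+ 1 / 27)
    (*-mono-≤ (0≤* 0≤sum 0≤sum) 0≤2 sum≤2 (*-mono-≤ 0≤sum 0≤2 sum≤2 sum≤2)))
  where
  0≤sum : 0ℚ ≤ a + b + c
  0≤sum = 0≤+ (0≤+ 0≤a 0≤b) 0≤c
  0≤2 : 0ℚ ≤ 1ℚ + 1ℚ
  0≤2 = nonNegative⁻¹ _

-- The Archimedean property and powers of 1/4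

fromℕ : ℕ → ℚ
fromℕ zero    = 0ℚ
fromℕ (suc n) = 1ℚ + fromℕ n

toℚᵘ-fromℕ : ∀ n → toℚᵘ (fromℕ n) ℚᵘ.≃ mkℚᵘ (+ n) 0
toℚᵘ-fromℕ zero    = ℚᵘ.≃-refl
toℚᵘ-fromℕ (suc n) = ℚᵘ.≃-trans (toℚᵘ-homo-+ 1ℚ (fromℕ n))
  (ℚᵘ.≃-trans (ℚᵘ.+-congʳ (toℚᵘ 1ℚ) (toℚᵘ-fromℕ n))
    (*≡* (cong (ℤ._* 1ℤ) (cong (λ m → 1ℤ ℤ.+ m) (ℤ.*-identityʳ (+ n))))))

-- The denominator of `ε` serves as `n`: the product is then the numerator, a positive integer.
archimedean : ∀ {ε} → 0ℚ < ε → ∃[ n ] 1ℚ ≤ ε * fromℕ n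
archimedean {mkℚ (+ zero)  _ _} (*<* (ℤ.+<+ ()))
archimedean {mkℚ -[1+ _ ]  _ _} (*<* ())
archimedean {ε@(mkℚ (+ suc m) d _)} _ = suc d , toℚᵘ-cancel-≤ (begin
  toℚᵘ 1ℚ                           ≤⟨ *≤* (ℤ.+≤+ le) ⟩
  toℚᵘ ε ℚᵘ.* mkℚᵘ (+ suc d) 0      ≃⟨ ℚᵘ.*-congˡ {toℚᵘ ε} (toℚᵘ-fromℕ (suc d)) ⟨
  toℚᵘ ε ℚᵘ.* toℚᵘ (fromℕ (suc d))  ≃⟨ toℚᵘ-homo-* ε (fromℕ (suc d)) ⟨
  toℚᵘ (ε * fromℕ (suc d))          ∎)
  where
  open ℚᵘ.≤-Reasoning
  le : 1 ℕ.* (suc d ℕ.* 1) ℕ.≤ suc m ℕ.* suc d ℕ.* 1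
  le = ℕ.≤-trans (ℕ.≤-reflexive (ℕ.*-identityˡ (suc d ℕ.* 1)))
    (ℕ.*-monoˡ-≤ 1 (ℕ.m≤n*m (suc d) (suc m)))

¼^_ : ℕ → ℚ
¼^ zero  = 1ℚ
¼^ suc n = ½ * (½ * ¼^ n)

0≤¼^ : ∀ n → 0ℚ ≤ ¼^ n
0≤¼^ zero    = nonNegative⁻¹ 1ℚ
0≤¼^ (suc n) = 0≤* {½} (nonNegative⁻¹ ½) (0≤* {½} (nonNegative⁻¹ ½) (0≤¼^ n))

¼^≤1 : ∀ n → ¼^ n ≤ 1ℚ
¼^≤1 zero    = ≤-refl
¼^≤1 (suc n) = ≤-trans (*-monoˡ-≤-nonNeg ½ (*-monoˡ-≤-nonNeg ½ (¼^≤1 n)))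
  (p≤p+nonNeg {½ * ½} {½ + ½ * ½} (nonNegative⁻¹ _))

-- A crude decay rate, enough to reduce convergence to the Archimedean property. In the induction
-- step both summands of `¼^ n + ¼^ n * fromℕ (suc n)` are at most 1, and a quarter of 2 is below 1.
¼^*fromℕ≤1 : ∀ n → ¼^ n * fromℕ (suc n) ≤ 1ℚ
¼^*fromℕ≤1 zero    = ≤-refl
¼^*fromℕ≤1 (suc n) = begin
  ½ * (½ * ¼^ n) * (1ℚ + fromℕ (suc n))
    ≡⟨ solve 2 (λ v m → con ½ :* (con ½ :* v) :* (con 1ℚ :+ m) :=
                         con ½ :* (con ½ :* (v :+ v :* m))) refl (¼^ n) (fromℕ (suc n)) ⟩
  ½ * (½ * (¼^ n + ¼^ n * fromℕ (suc n)))
    ≤⟨ *-monoˡ-≤-nonNeg ½ (*-monoˡ-≤-nonNeg ½ (+-mono-≤ (¼^≤1 n) (¼^*fromℕ≤1 n))) ⟩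
  ½ * (½ * (1ℚ + 1ℚ))
    ≤⟨ p≤p+nonNeg {½} {½} (nonNegative⁻¹ ½) ⟩
  1ℚ ∎
  where open ≤-Reasoning

¼^-vanishes : ∀ {ε} → 0ℚ < ε → ∃[ n ] ¼^ n < ε
¼^-vanishes {ε} 0<ε with n , 1≤ε*n ← archimedean 0<ε =
  n , *-cancelʳ-<-nonNeg (fromℕ (suc n)) {{nonNegative (0≤fromℕ (suc n))}} (begin-strict
    ¼^ n * fromℕ (suc n)  ≤⟨ ¼^*fromℕ≤1 n ⟩
    1ℚ                    ≡⟨ +-identityˡ 1ℚ ⟨
    -- The additional `ε` gained by passing from `n` to `suc n` makes the inequality strict.
    0ℚ + 1ℚ               <⟨ +-mono-<-≤ 0<ε 1≤ε*n ⟩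
    ε + ε * fromℕ n       ≡⟨ solve 2 (λ e n → e :+ e :* n := e :* (con 1ℚ :+ n)) refl ε (fromℕ n) ⟩
    ε * fromℕ (suc n)     ∎)
  where
  open ≤-Reasoning
  0≤fromℕ : ∀ n → 0ℚ ≤ fromℕ n
  0≤fromℕ zero    = ≤-refl
  0≤fromℕ (suc n) = 0≤+ (nonNegative⁻¹ 1ℚ) (0≤fromℕ n)

-- Transitions and expected payoffs

Config : Set
Config = Configuration [] (D int)

Answer : Config → ℤ → Set
Answer c n = Trace c (ret□ ∙ con n)

-- There is no stuck case, since configurations are closed and typed. Completeness is stated for
-- traces to an answer, the form in which `strip` and `split` sort lists of traces by their first
-- transition.
data Transitions : Config → Set where
  answer : ∀ n → Transitions (ret□ ∙ con n)
  det    : ∀ {c c′} (r : c ⟶[ 1ℚ ] c′) →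
           (∀ {n} (t : Answer c n) → ∃[ t′ ] t ≡ r ∷ t′) → Transitions c
  choice : ∀ {c c₁ c₂} (l : c ⟶[ ½ ] c₁) (r : c ⟶[ ½ ] c₂) →
           (∀ {n} (t : Answer c n) →
              (∃[ t′ ] t ≡ l ∷ t′) ⊎ (∃[ t′ ] t ≡ r ∷ t′)) →
           Transitions c

transitions : ∀ c → Transitions c
transitions (C ∙ s M) = det explore-s λ { (explore-s ∷ t) → t , refl }
transitions (C ∙ p M) = det explore-p λ { (explore-p ∷ t) → t , refl }
transitions (C ∙ (if M =0then N else P)) =
  det explore-if λ { (explore-if ∷ t) → t , refl }
transitions (C ∙ rec c M) = det unfold λ { (unfold ∷ t) → t , refl }
transitions (C ∙ M $ N) = det explore-$ λ { (explore-$ ∷ t) → t , refl }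
transitions (C ∙ M ⊕ N) = choice ⊕-left ⊕-right λ where
  (⊕-left  ∷ t) → inj₁ (t , refl)
  (⊕-right ∷ t) → inj₂ (t , refl)
transitions (C ∙ bind M N) = det explore-bind λ { (explore-bind ∷ t) → t , refl }
transitions (C ▹ -$ N ∙ ƛ M) = det β λ { (β ∷ t) → t , refl }
transitions (□ ∙ ret M) = det explore-ret λ { (explore-ret ∷ t) → t , refl }
transitions (C ▹ bind- N ∙ ret M) = det bind-ret λ { (bind-ret ∷ t) → t , refl }
transitions (ret□ ∙ con n) = answer n
transitions (C ▹ s- ∙ con n) = det succ λ { (succ ∷ t) → t , refl }
transitions (C ▹ p- ∙ con n) = det pred λ { (pred ∷ t) → t , refl }
transitions (C ▹ (if-=0then N else P) ∙ con (+ zero)) = det if≡0 λ where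
  (if≡0 ∷ t)     → t , refl
  (if≢0 0≢0 ∷ t) → ⊥-elim-irr (0≢0 refl)
transitions (C ▹ (if-=0then N else P) ∙ con (+ suc n)) =
  det (if≢0 (λ ())) λ { (if≢0 _ ∷ t) → t , refl }
transitions (C ▹ (if-=0then N else P) ∙ con -[1+ n ]) =
  det (if≢0 (λ ())) λ { (if≢0 _ ∷ t) → t , refl }

-- eval Q k c is the expected payoff of the runs from c that reach an
-- answer within fewer than k steps, where the answer n pays Q n.

Payoff : Set
Payoff = ℤ → ℚ

mutual
  eval : Payoff → ℕ → Config → ℚ
  eval Q zero    c = 0ℚ
  eval Q (suc k) c = evalNext Q k (transitions c)

  evalNext : ∀ {c} → Payoff → ℕ → Transitions c → ℚ
  evalNext Q k (answer n)                  = Q n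
  evalNext Q k (det {c′ = c} _ _)          = eval Q k c
  evalNext Q k (choice {c₁ = c} {d} _ _ _) = mean (eval Q k c) (eval Q k d)

isZero nonZero : Payoff
isZero (+ zero)  = 1ℚ
isZero (+ suc _) = 0ℚ
isZero -[1+ _ ]  = 0ℚ
nonZero n = 1ℚ - isZero n

0≤isZero : ∀ n → 0ℚ ≤ isZero n
0≤isZero (+ zero)  = nonNegative⁻¹ 1ℚ
0≤isZero (+ suc _) = ≤-refl
0≤isZero -[1+ _ ]  = ≤-refl

isZero≤1 : ∀ n → isZero n ≤ 1ℚ
isZero≤1 (+ zero)  = ≤-refl
isZero≤1 (+ suc _) = nonNegative⁻¹ 1ℚ
isZero≤1 -[1+ _ ]  = nonNegative⁻¹ 1ℚ

0≤nonZero : ∀ n → 0ℚ ≤ nonZero n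
0≤nonZero (+ zero)  = ≤-refl
0≤nonZero (+ suc _) = nonNegative⁻¹ 1ℚ
0≤nonZero -[1+ _ ]  = nonNegative⁻¹ 1ℚ

nonZero≤1 : ∀ n → nonZero n ≤ 1ℚ
nonZero≤1 (+ zero)  = nonNegative⁻¹ 1ℚ
nonZero≤1 (+ suc _) = ≤-refl
nonZero≤1 -[1+ _ ]  = ≤-refl

module _ {Q : Payoff} (0≤Q : ∀ n → 0ℚ ≤ Q n) where

  0≤eval : ∀ k c → 0ℚ ≤ eval Q k c
  0≤eval zero    c = ≤-refl
  0≤eval (suc k) c with transitions c
  ... | answer n     = 0≤Q n
  ... | det _ _      = 0≤eval k _
  ... | choice _ _ _ = mean-mono (0≤eval k _) (0≤eval k _)

  eval-suc : ∀ k c → eval Q k c ≤ eval Q (suc k) c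
  eval-suc zero    c = 0≤eval 1 c
  eval-suc (suc k) c with transitions c
  ... | answer n     = ≤-refl
  ... | det _ _      = eval-suc k _
  ... | choice _ _ _ = mean-mono (eval-suc k _) (eval-suc k _)

  eval≤1 : (∀ n → Q n ≤ 1ℚ) → ∀ k c → eval Q k c ≤ 1ℚ
  eval≤1 Q≤1 zero    c = nonNegative⁻¹ 1ℚ
  eval≤1 Q≤1 (suc k) c with transitions c
  ... | answer n     = Q≤1 n
  ... | det _ _      = eval≤1 Q≤1 k _
  ... | choice _ _ _ = mean-mono (eval≤1 Q≤1 k _) (eval≤1 Q≤1 k _)

  eval-+ : ∀ m k c → eval Q k c ≤ eval Q (m ℕ.+ k) c
  eval-+ zero    k c = ≤-refl
  eval-+ (suc m) k c = ≤-trans (eval-+ m k c) (eval-suc (m ℕ.+ k) c)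

-- Linearity of the expectation; it pulls a uniform bound `w` on what follows a call out as a
-- factor.
eval-scale : ∀ w Q k c → eval (λ n → Q n * w) k c ≡ eval Q k c * w
eval-scale w Q zero    c = sym (*-zeroˡ w)
eval-scale w Q (suc k) c with transitions c
... | answer n     = refl
... | det _ _      = eval-scale w Q k _
... | choice _ _ _ = ≡.trans
  (cong₂ mean (eval-scale w Q k _) (eval-scale w Q k _))
  (mean-*ʳ (eval Q k _) (eval Q k _) w)

-- Weights of finite lists of traces

steps : ∀ {Γ τ} {c d : Configuration Γ τ} → Trace c d → ℕ
steps []      = 0
steps (_ ∷ t) = suc (steps t)

totalWeight-map : ∀ {Γ τ} {c c′ d : Configuration Γ τ} {α} (r : c ⟶[ α ] c′)
  (ts : List (Trace c′ d)) → totalWeight (map (r ∷_) ts) ≡ α * totalWeight ts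
totalWeight-map {α = α} r []       = sym (*-zeroʳ α)
totalWeight-map {α = α} r (t ∷ ts) = ≡.trans
  (cong (λ x → α * weight t + x) (totalWeight-map r ts))
  (sym (*-distribˡ-+ α (weight t) (totalWeight ts)))

totalWeight-++ : ∀ {Γ τ} {c d : Configuration Γ τ} (ts us : List (Trace c d)) →
  totalWeight (ts ++ us) ≡ totalWeight ts + totalWeight us
totalWeight-++ []       us = sym (+-identityˡ _)
totalWeight-++ (t ∷ ts) us = ≡.trans
  (cong (λ x → weight t + x) (totalWeight-++ ts us))
  (sym (+-assoc (weight t) (totalWeight ts) (totalWeight us)))

totalWeight-↭ : ∀ {Γ τ} {c d : Configuration Γ τ} {ts us : List (Trace c d)} →
  ts ↭ us → totalWeight ts ≡ totalWeight us
totalWeight-↭ ts↭us = Permutation.foldr-commMonoid (≡.setoid ℚ)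
  +-0-isCommutativeMonoid (↭⇒↭ₛ (map⁺ weight ts↭us))

strip : ∀ {n c c′ α} (r : c ⟶[ α ] c′) →
  (∀ t → ∃[ t′ ] t ≡ r ∷ t′) → (ts : List (Answer c n)) →
  ∃[ us ] ts ≡ map (r ∷_) us
strip r first []       = [] , refl
strip r first (t ∷ ts) with first t | strip r first ts
... | t′ , refl | us , refl = t′ ∷ us , refl

-- The two kinds of traces may be interleaved in `ts`, so the decomposition holds only up to
-- permutation, which preserves total weight and uniqueness.
split : ∀ {n c c₁ c₂ α β} (l : c ⟶[ α ] c₁) (r : c ⟶[ β ] c₂) →
  (∀ t → (∃[ t′ ] t ≡ l ∷ t′) ⊎ (∃[ t′ ] t ≡ r ∷ t′)) →
  (ts : List (Answer c n)) →
  ∃₂ λ us vs → ts ↭ map (l ∷_) us ++ map (r ∷_) vs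
split l r first []       = [] , [] , refl
split l r first (t ∷ ts) with first t | split l r first ts
... | inj₁ (t′ , refl) | us , vs , ts↭ = t′ ∷ us , vs , prep _ ts↭
... | inj₂ (t′ , refl) | us , vs , ts↭ = us , t′ ∷ vs ,
  ↭-trans (prep _ ts↭) (↭-sym (shift _ (map (l ∷_) us) (map (r ∷_) vs)))

unique-++⁻ : ∀ {A : Set} (xs : List A) {ys} →
  Unique (xs ++ ys) → Unique xs × Unique ys
unique-++⁻ []       unique = [] , unique
unique-++⁻ (x ∷ xs) (x∉ ∷ unique) with uniqueˡ , uniqueʳ ← unique-++⁻ xs unique =
  All.++⁻ˡ xs x∉ ∷ uniqueˡ , uniqueʳ

-- Induction on the step budget: removing a common first transition keeps traces distinct, and a
-- coin flip averages the two parts. At an answer only the empty trace exists, so uniqueness allows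
-- it once. The bound on `steps` is strict because `eval` spends one unit of budget on reading off
-- an answer.
totalWeight≤eval : ∀ {Q n} → (∀ m → 0ℚ ≤ Q m) → Q n ≡ 1ℚ →
  ∀ k {c} {ts : List (Answer c n)} → Unique ts → All (λ t → steps t ℕ.< k) ts →
  totalWeight ts ≤ eval Q k c
totalWeight≤eval {Q} {n} 0≤Q Qn≡1 = go
  where
  go : ∀ k {c} {ts : List (Answer c n)} → Unique ts → All (λ t → steps t ℕ.< k) ts →
       totalWeight ts ≤ eval Q k c
  go zero {ts = []}    _ _        = ≤-refl
  go zero {ts = _ ∷ _} _ (() ∷ _)
  go (suc k) {c} {ts} unique short with transitions c
  go (suc k) {ts = []}          _ _ | answer m = 0≤Q m
  go (suc k) {ts = [] ∷ []}     _ _ | answer m = ≤-reflexive (sym Qn≡1)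
  go (suc k) {ts = [] ∷ [] ∷ _} ((t≢t ∷ _) ∷ _) _ | answer m = ⊥-elim (t≢t refl)
  go (suc k) {ts = ts} unique short | det {c′ = c′} r first
    with us , refl ← strip r first ts = begin
    totalWeight (map (r ∷_) us) ≡⟨ totalWeight-map r us ⟩
    1ℚ * totalWeight us         ≡⟨ *-identityˡ _ ⟩
    totalWeight us              ≤⟨ go k (Unique.map⁻ unique)
                                     (All.map ℕ.s≤s⁻¹ (All.map⁻ short)) ⟩
    eval Q k c′                 ∎
    where open ≤-Reasoning
  go (suc k) {ts = ts} unique short | choice {c₁ = c₁} {c₂} l r first
    with us , vs , ts↭ ← split l r first ts = begin
    totalWeight ts                                        ≡⟨ totalWeight-↭ ts↭ ⟩
    totalWeight (map (l ∷_) us ++ map (r ∷_) vs)          ≡⟨ totalWeight-++ (map (l ∷_) us) _ ⟩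
    totalWeight (map (l ∷_) us) + totalWeight (map (r ∷_) vs)
      ≡⟨ cong₂ _+_ (totalWeight-map l us) (totalWeight-map r vs) ⟩
    mean (totalWeight us) (totalWeight vs)
      ≤⟨ mean-mono (go k (Unique.map⁻ uniqueˡ) (All.map ℕ.s≤s⁻¹ (All.map⁻ shortˡ)))
                   (go k (Unique.map⁻ uniqueʳ) (All.map ℕ.s≤s⁻¹ (All.map⁻ shortʳ))) ⟩
    mean (eval Q k c₁) (eval Q k c₂) ∎
    where
    open ≤-Reasoning
    unique′ = Permutation.Unique-resp-↭ (≡.setoid _) (↭⇒↭ₛ ts↭) unique
    uniqueˡ = proj₁ (unique-++⁻ (map (l ∷_) us) unique′)
    uniqueʳ = proj₂ (unique-++⁻ (map (l ∷_) us) unique′)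
    short′ = All-resp-↭ ts↭ short
    shortˡ = All.++⁻ˡ (map (l ∷_) us) short′
    shortʳ = All.++⁻ʳ (map (l ∷_) us) short′

-- Substitution

cong-if : ∀ {Γ τ} {M M′ : Term Γ int} {N N′ P P′ : Term Γ τ} →
  M ≡ M′ → N ≡ N′ → P ≡ P′ →
  (if M =0then N else P) ≡ (if M′ =0then N′ else P′)
cong-if refl refl refl = refl

subst-cong : ∀ {Γ Δ} {θ φ : Substitution Γ Δ} →
  (∀ {τ} (x : Γ ∋ τ) → θ x ≡ φ x) →
  ∀ {τ} (M : Term Γ τ) → subst θ M ≡ subst φ M
subst-cong θ≗φ (var x)    = θ≗φ x
subst-cong θ≗φ (con n)    = refl
subst-cong θ≗φ (s M)      = cong s (subst-cong θ≗φ M)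
subst-cong θ≗φ (p M)      = cong p (subst-cong θ≗φ M)
subst-cong θ≗φ (if M =0then N else P) =
  cong-if (subst-cong θ≗φ M) (subst-cong θ≗φ N) (subst-cong θ≗φ P)
subst-cong θ≗φ (rec c M)  = cong (rec c) (subst-cong θ≗φ M)
subst-cong θ≗φ (M $ N)    = cong₂ _$_ (subst-cong θ≗φ M) (subst-cong θ≗φ N)
subst-cong θ≗φ (ƛ M)      = cong ƛ_ (subst-cong lifted M)
  where
  lifted : ∀ {τ} (x : _ ∋ τ) → _
  lifted here      = refl
  lifted (there x) = cong (rename there) (θ≗φ x)
subst-cong θ≗φ (M ⊕ N)    = cong₂ _⊕_ (subst-cong θ≗φ M) (subst-cong θ≗φ N)
subst-cong θ≗φ (ret M)    = cong ret (subst-cong θ≗φ M)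
subst-cong θ≗φ (bind M N) = cong₂ bind (subst-cong θ≗φ M) (subst-cong θ≗φ N)

rename≡subst : ∀ {Γ Δ} (ρ : Renaming Γ Δ) {τ} (M : Term Γ τ) →
  rename ρ M ≡ subst (var ∘ ρ) M
rename≡subst ρ (var x)    = refl
rename≡subst ρ (con n)    = refl
rename≡subst ρ (s M)      = cong s (rename≡subst ρ M)
rename≡subst ρ (p M)      = cong p (rename≡subst ρ M)
rename≡subst ρ (if M =0then N else P) =
  cong-if (rename≡subst ρ M) (rename≡subst ρ N) (rename≡subst ρ P)
rename≡subst ρ (rec c M)  = cong (rec c) (rename≡subst ρ M)
rename≡subst ρ (M $ N)    = cong₂ _$_ (rename≡subst ρ M) (rename≡subst ρ N)
rename≡subst ρ (ƛ M)      =
  cong ƛ_ (≡.trans (rename≡subst (liftᵣ ρ) M) (subst-cong lifted M))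
  where
  lifted : ∀ {τ} (x : _ ∋ τ) → var (liftᵣ ρ x) ≡ liftₛ (var ∘ ρ) x
  lifted here      = refl
  lifted (there x) = refl
rename≡subst ρ (M ⊕ N)    = cong₂ _⊕_ (rename≡subst ρ M) (rename≡subst ρ N)
rename≡subst ρ (ret M)    = cong ret (rename≡subst ρ M)
rename≡subst ρ (bind M N) = cong₂ bind (rename≡subst ρ M) (rename≡subst ρ N)

subst-rename : ∀ {Γ Δ Θ} (θ : Substitution Δ Θ) (ρ : Renaming Γ Δ)
  {τ} (M : Term Γ τ) → subst θ (rename ρ M) ≡ subst (θ ∘ ρ) M
subst-rename θ ρ (var x)    = refl
subst-rename θ ρ (con n)    = refl
subst-rename θ ρ (s M)      = cong s (subst-rename θ ρ M)
subst-rename θ ρ (p M)      = cong p (subst-rename θ ρ M)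
subst-rename θ ρ (if M =0then N else P) =
  cong-if (subst-rename θ ρ M) (subst-rename θ ρ N) (subst-rename θ ρ P)
subst-rename θ ρ (rec c M)  = cong (rec c) (subst-rename θ ρ M)
subst-rename θ ρ (M $ N)    = cong₂ _$_ (subst-rename θ ρ M) (subst-rename θ ρ N)
subst-rename θ ρ (ƛ M)      =
  cong ƛ_ (≡.trans (subst-rename (liftₛ θ) (liftᵣ ρ) M) (subst-cong lifted M))
  where
  lifted : ∀ {τ} (x : _ ∋ τ) → liftₛ θ (liftᵣ ρ x) ≡ liftₛ (θ ∘ ρ) x
  lifted here      = refl
  lifted (there x) = refl
subst-rename θ ρ (M ⊕ N)    = cong₂ _⊕_ (subst-rename θ ρ M) (subst-rename θ ρ N)
subst-rename θ ρ (ret M)    = cong ret (subst-rename θ ρ M)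
subst-rename θ ρ (bind M N) = cong₂ bind (subst-rename θ ρ M) (subst-rename θ ρ N)

rename-rename : ∀ {Γ Δ Θ} (ρ′ : Renaming Δ Θ) (ρ : Renaming Γ Δ)
  {τ} (M : Term Γ τ) → rename ρ′ (rename ρ M) ≡ subst (var ∘ ρ′ ∘ ρ) M
rename-rename ρ′ ρ M =
  ≡.trans (rename≡subst ρ′ (rename ρ M)) (subst-rename (var ∘ ρ′) ρ M)

rename-subst : ∀ {Γ Δ Θ} (ρ : Renaming Δ Θ) (θ : Substitution Γ Δ)
  {τ} (M : Term Γ τ) → rename ρ (subst θ M) ≡ subst (rename ρ ∘ θ) M
rename-subst ρ θ (var x)    = refl
rename-subst ρ θ (con n)    = refl
rename-subst ρ θ (s M)      = cong s (rename-subst ρ θ M)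
rename-subst ρ θ (p M)      = cong p (rename-subst ρ θ M)
rename-subst ρ θ (if M =0then N else P) =
  cong-if (rename-subst ρ θ M) (rename-subst ρ θ N) (rename-subst ρ θ P)
rename-subst ρ θ (rec c M)  = cong (rec c) (rename-subst ρ θ M)
rename-subst ρ θ (M $ N)    = cong₂ _$_ (rename-subst ρ θ M) (rename-subst ρ θ N)
rename-subst ρ θ (ƛ M)      =
  cong ƛ_ (≡.trans (rename-subst (liftᵣ ρ) (liftₛ θ) M) (subst-cong lifted M))
  where
  lifted : ∀ {τ} (x : _ ∋ τ) → rename (liftᵣ ρ) (liftₛ θ x) ≡ liftₛ (rename ρ ∘ θ) x
  lifted here      = refl
  lifted (there x) = ≡.trans (rename-rename (liftᵣ ρ) there (θ x))
                        (sym (rename-rename there ρ (θ x)))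
rename-subst ρ θ (M ⊕ N)    = cong₂ _⊕_ (rename-subst ρ θ M) (rename-subst ρ θ N)
rename-subst ρ θ (ret M)    = cong ret (rename-subst ρ θ M)
rename-subst ρ θ (bind M N) = cong₂ bind (rename-subst ρ θ M) (rename-subst ρ θ N)

subst-subst : ∀ {Γ Δ Θ} (θ : Substitution Δ Θ) (φ : Substitution Γ Δ)
  {τ} (M : Term Γ τ) → subst θ (subst φ M) ≡ subst (subst θ ∘ φ) M
subst-subst θ φ (var x)    = refl
subst-subst θ φ (con n)    = refl
subst-subst θ φ (s M)      = cong s (subst-subst θ φ M)
subst-subst θ φ (p M)      = cong p (subst-subst θ φ M)
subst-subst θ φ (if M =0then N else P) =
  cong-if (subst-subst θ φ M) (subst-subst θ φ N) (subst-subst θ φ P)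
subst-subst θ φ (rec c M)  = cong (rec c) (subst-subst θ φ M)
subst-subst θ φ (M $ N)    = cong₂ _$_ (subst-subst θ φ M) (subst-subst θ φ N)
subst-subst θ φ (ƛ M)      =
  cong ƛ_ (≡.trans (subst-subst (liftₛ θ) (liftₛ φ) M) (subst-cong lifted M))
  where
  lifted : ∀ {τ} (x : _ ∋ τ) → subst (liftₛ θ) (liftₛ φ x) ≡ liftₛ (subst θ ∘ φ) x
  lifted here      = refl
  lifted (there x) = ≡.trans (subst-rename (liftₛ θ) there (φ x))
                        (sym (rename-subst there θ (φ x)))
subst-subst θ φ (M ⊕ N)    = cong₂ _⊕_ (subst-subst θ φ M) (subst-subst θ φ N)
subst-subst θ φ (ret M)    = cong ret (subst-subst θ φ M)
subst-subst θ φ (bind M N) = cong₂ bind (subst-subst θ φ M) (subst-subst θ φ N)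

subst-var : ∀ {Γ τ} (M : Term Γ τ) → subst var M ≡ M
subst-var (var x)    = refl
subst-var (con n)    = refl
subst-var (s M)      = cong s (subst-var M)
subst-var (p M)      = cong p (subst-var M)
subst-var (if M =0then N else P) =
  cong-if (subst-var M) (subst-var N) (subst-var P)
subst-var (rec c M)  = cong (rec c) (subst-var M)
subst-var (M $ N)    = cong₂ _$_ (subst-var M) (subst-var N)
subst-var (ƛ M)      = cong ƛ_ (≡.trans (subst-cong lifted M) (subst-var M))
  where
  lifted : ∀ {τ} (x : _ ∋ τ) → liftₛ var x ≡ var x
  lifted here      = refl
  lifted (there x) = refl
subst-var (M ⊕ N)    = cong₂ _⊕_ (subst-var M) (subst-var N)
subst-var (ret M)    = cong ret (subst-var M)
subst-var (bind M N) = cong₂ bind (subst-var M) (subst-var N)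

-- Instantiating free variables commutes with β-reduction, so a run of an open term can be followed
-- under several instances at once.
subst-[0:=] : ∀ {Γ Δ σ τ} (θ : Substitution Γ Δ) (M : Term (σ ∷ Γ) τ) (N : Term Γ σ) →
  subst θ (M [0:= N ]) ≡ subst (liftₛ θ) M [0:= subst θ N ]
subst-[0:=] θ M N = ≡.trans (subst-subst θ (single N) M)
  (≡.trans (subst-cong pointwise M)
    (sym (subst-subst (single (subst θ N)) (liftₛ θ) M)))
  where
  pointwise : ∀ {τ} (x : _ ∋ τ) →
    subst θ (single N x) ≡ subst (single (subst θ N)) (liftₛ θ x)
  pointwise here      = refl
  pointwise (there x) = sym (≡.trans
    (subst-rename (single (subst θ N)) there (θ x)) (subst-var (θ x)))

weaken-[0:=] : ∀ {Γ σ τ} (F : Term Γ τ) (M : Term Γ σ) → rename there F [0:= M ] ≡ F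
weaken-[0:=] F M = ≡.trans (subst-rename (single M) there F) (subst-var F)

-- The calls made by portest

substᴱ : ∀ {Γ Δ σ τ} → Substitution Γ Δ → Elementary Γ σ τ → Elementary Δ σ τ
substᴱ θ (-$ N)                  = -$ subst θ N
substᴱ θ s-                      = s-
substᴱ θ p-                      = p-
substᴱ θ (if-=0then N else P)    = if-=0then subst θ N else subst θ P
substᴱ θ (bind- N)               = bind- (subst θ N)

substᶜ : ∀ {Γ Δ σ τ} → Substitution Γ Δ → Context Γ σ τ → Context Δ σ τ
substᶜ θ □       = □
substᶜ θ ret□    = ret□
substᶜ θ (C ▹ E) = substᶜ θ C ▹ substᴱ θ E

Args : Scope
Args = D int ∷ D int ∷ []

args : Ground (D int) → Ground (D int) → Substitution Args []
args M N here         = M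
args M N (there here) = N

-- The argument pairs of the three calls of `portest`, seen as instances of one pair of free
-- variables.
θ₁ θ₂ θ₃ : Substitution Args []
θ₁ = args (ret (con 1ℤ)) (ret (con 1ℤ))
θ₂ = args (ret (con 0ℤ)) Ω
θ₃ = args Ω (ret (con 0ℤ))

-- `Ω` returns to itself after three transitions: `unfold`, `explore-$` and `β`.
evalΩ : ∀ Q k (C : Context [] (D int) (D int)) → eval Q k (C ∙ Ω) ≡ 0ℚ
evalΩ Q zero                C = refl
evalΩ Q (suc zero)          C = refl
evalΩ Q (suc (suc zero))    C = refl
evalΩ Q (suc (suc (suc k))) C = evalΩ Q k C

run : Payoff → ℕ → Substitution Args [] → ∀ {σ} →
      Context Args σ (D int) → Term Args σ → ℚ
run Q k θ C M = eval Q k (substᶜ θ C ∙ subst θ M)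

run≤1 : ∀ {Q} → (∀ n → 0ℚ ≤ Q n) → (∀ n → Q n ≤ 1ℚ) →
  ∀ k (θ : Substitution Args []) {σ} (C : Context Args σ (D int)) M → run Q k θ C M ≤ 1ℚ
run≤1 0≤Q Q≤1 k θ C M = eval≤1 0≤Q Q≤1 k (substᶜ θ C ∙ subst θ M)

-- As long as the head is not a variable, the three instances make the same transitions. When a
-- variable is reached, `θ₃` makes the first one `Ω` and `θ₂` the second one, so one summand
-- vanishes and the other two are at most 1.
three-calls : ∀ k {σ} (C : Context Args σ (D int)) (M : Term Args σ) →
  run nonZero k θ₁ C M + run isZero k θ₂ C M + run isZero k θ₃ C M ≤ 1ℚ + 1ℚ
three-calls zero C M = nonNegative⁻¹ _
three-calls (suc k) C (var here) = +³-mono-≤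
  (run≤1 0≤nonZero nonZero≤1 (suc k) θ₁ C (var here))
  (run≤1 0≤isZero isZero≤1 (suc k) θ₂ C (var here))
  (≤-reflexive (evalΩ isZero (suc k) (substᶜ θ₃ C)))
three-calls (suc k) C (var (there here)) = +³-mono-≤
  (run≤1 0≤nonZero nonZero≤1 (suc k) θ₁ C (var (there here)))
  (≤-reflexive (evalΩ isZero (suc k) (substᶜ θ₂ C)))
  (run≤1 0≤isZero isZero≤1 (suc k) θ₃ C (var (there here)))
-- The answer 0 pays 0 + 1 + 1, any other answer pays 1 + 0 + 0.
three-calls (suc k) ret□ (con (+ zero))  = ≤-refl
three-calls (suc k) ret□ (con (+ suc _)) = 1≤2
three-calls (suc k) ret□ (con -[1+ _ ])  = 1≤2
three-calls (suc k) (C ▹ s-) (con n) = three-calls k C (con (n ℤ.+ 1ℤ))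
three-calls (suc k) (C ▹ p-) (con n) = three-calls k C (con (n ℤ.- 1ℤ))
three-calls (suc k) (C ▹ (if-=0then N else P)) (con (+ zero))  = three-calls k C N
three-calls (suc k) (C ▹ (if-=0then N else P)) (con (+ suc _)) = three-calls k C P
three-calls (suc k) (C ▹ (if-=0then N else P)) (con -[1+ _ ])  = three-calls k C P
three-calls (suc k) C (s M) = three-calls k (C ▹ s-) M
three-calls (suc k) C (p M) = three-calls k (C ▹ p-) M
three-calls (suc k) C (if M =0then N else P) =
  three-calls k (C ▹ (if-=0then N else P)) M
three-calls (suc k) C (rec c M) = three-calls k C (M $ rec c M)
three-calls (suc k) C (M $ N) = three-calls k (C ▹ -$ N) M
-- The three contracta have to be recognised as instances of the single open term `M [0:= N ]`.
three-calls (suc k) (C ▹ -$ N) (ƛ M)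
  rewrite sym (subst-[0:=] θ₁ M N)
        | sym (subst-[0:=] θ₂ M N)
        | sym (subst-[0:=] θ₃ M N) = three-calls k C (M [0:= N ])
three-calls (suc k) C (M ⊕ N) = ≤-trans
  (≤-reflexive (mean-+³ (run nonZero k θ₁ C M) (run nonZero k θ₁ C N)
                        (run isZero k θ₂ C M) (run isZero k θ₂ C N)
                        (run isZero k θ₃ C M) (run isZero k θ₃ C N)))
  (mean-mono (three-calls k C M) (three-calls k C N))
three-calls (suc k) □ (ret M) = three-calls k ret□ M
three-calls (suc k) (C ▹ bind- N) (ret M) = three-calls k C (N $ M)
three-calls (suc k) C (bind M N) = three-calls k (C ▹ bind- N) M

-- A run of a computation whose answer is tested for 0 mirrors the run of
-- the computation alone: □ and ret□ are replaced by the test.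
module Test (K : Context [] (D int) (D int)) (N P : Term (int ∷ []) (D int)) where

  test : Elementary [] (D int) (D int)
  test = bind- (ƛ if var here =0then N else P)

  infix 4 _∼_

  -- `bind` passes on the returned term unevaluated, so `ret□ M` records `M` itself, which both
  -- branches may contain.
  data _∼_ : ∀ {σ} → Context [] σ (D int) → Context [] σ (D int) → Set where
    □    : □ ∼ K ▹ test
    ret□ : ∀ M → ret□ ∼ K ▹ (if-=0then (N [0:= M ]) else (P [0:= M ]))
    _▹_  : ∀ {ρ σ} {C C′ : Context [] σ (D int)} →
           C ∼ C′ → (E : Elementary [] ρ σ) → C ▹ E ∼ C′ ▹ E

  module _ (Q R : Payoff) (0≤Q : ∀ n → 0ℚ ≤ Q n) where

    Bounded : ℕ → Set
    Bounded k = (∀ M → eval Q k (K ∙ N [0:= M ]) ≤ R 0ℤ) ×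
                (∀ n → n ≢ 0ℤ → ∀ M → eval Q k (K ∙ P [0:= M ]) ≤ R n)

    bounded-pred : ∀ {k} → Bounded (suc k) → Bounded k
    bounded-pred {k} (N≤ , P≤) =
      (λ M → ≤-trans (eval-suc 0≤Q k _) (N≤ M)) ,
      (λ n n≢0 M → ≤-trans (eval-suc 0≤Q k _) (P≤ n n≢0 M))

    -- Where the computation alone is paid `R n`, the tested one continues with the branch chosen by
    -- `n`; `Bounded` says that `R n` covers what that branch still earns.
    bounded : ∀ k → Bounded k → ∀ {σ} {C C′ : Context [] σ (D int)} → C ∼ C′ →
              ∀ M → eval Q k (C′ ∙ M) ≤ eval R k (C ∙ M)
    bounded zero    _ _ _ = ≤-refl
    bounded (suc k) b (ret□ M) (con (+ zero)) = proj₁ (bounded-pred b) M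
    bounded (suc k) b (ret□ M) (con (+ suc n)) = proj₂ (bounded-pred b) _ (λ ()) M
    bounded (suc k) b (ret□ M) (con -[1+ n ]) = proj₂ (bounded-pred b) _ (λ ()) M
    bounded (suc k) b (c ▹ s-) (con n) = bounded k (bounded-pred b) c _
    bounded (suc k) b (c ▹ p-) (con n) = bounded k (bounded-pred b) c _
    bounded (suc k) b (c ▹ (if-=0then L else L′)) (con (+ zero)) = bounded k (bounded-pred b) c _
    bounded (suc k) b (c ▹ (if-=0then L else L′)) (con (+ suc n)) = bounded k (bounded-pred b) c _
    bounded (suc k) b (c ▹ (if-=0then L else L′)) (con -[1+ n ]) = bounded k (bounded-pred b) c _
    bounded (suc k) b c (s M) = bounded k (bounded-pred b) (c ▹ s-) M
    bounded (suc k) b c (p M) = bounded k (bounded-pred b) (c ▹ p-) M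
    bounded (suc k) b c (if M =0then L else L′) =
      bounded k (bounded-pred b) (c ▹ (if-=0then L else L′)) M
    bounded (suc k) b c (rec d M) = bounded k (bounded-pred b) c _
    bounded (suc k) b c (M $ L) = bounded k (bounded-pred b) (c ▹ -$ L) M
    bounded (suc k) b (c ▹ -$ L) (ƛ M) = bounded k (bounded-pred b) c _
    bounded (suc k) b c (M ⊕ L) = mean-mono
      (bounded k (bounded-pred b) c M) (bounded k (bounded-pred b) c L)
    -- The tested run needs four transitions to reach `M`, against one for the plain run. Three
    -- extra units of budget on the left make up for this and can only increase its payoff.
    bounded (suc k) b □ (ret M) = ≤-trans (eval-+ 0≤Q 3 k _)
      (bounded k (bounded-pred b) (ret□ M) M)
    bounded (suc k) b (c ▹ bind- L) (ret M) = bounded k (bounded-pred b) c _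
    bounded (suc k) b c (bind M L) = bounded k (bounded-pred b) (c ▹ bind- L) M

-- Success of `portest` bounded by a product

Ω-bounded : ∀ k w → eval isZero k (□ ∙ Ω) ≤ 0ℚ * w
Ω-bounded k w = ≤-reflexive (≡.trans (evalΩ isZero k □) (sym (*-zeroˡ w)))

1*-bounded : ∀ {w x} → x ≤ w → x ≤ 1ℚ * w
1*-bounded {w} x≤w = ≤-trans x≤w (≤-reflexive (sym (*-identityˡ w)))

-- The answer 0 leads to `Ω` and earns nothing, every other answer earns at most `w`; hence the
-- payoff `nonZero n * w` suffices in `bounded`.
eval-do-nonZero : ∀ {w P} k →
  (∀ M → eval isZero k (□ ∙ P [0:= M ]) ≤ w) → ∀ L →
  eval isZero k (□ ∙ Do L ⨾ if var here =0then Ω else P) ≤ eval nonZero k (□ ∙ L) * w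
eval-do-nonZero {w} {P} k P≤w L = ≤-trans (eval-suc 0≤isZero k _)
  (≤-trans (bounded isZero (λ n → nonZero n * w) 0≤isZero k ((λ _ → Ω-bounded k w) , P≤) □ L)
    (≤-reflexive (eval-scale w nonZero k _)))
  where
  open Test □ Ω P
  P≤ : ∀ n → n ≢ 0ℤ → ∀ M → eval isZero k (□ ∙ P [0:= M ]) ≤ nonZero n * w
  P≤ (+ zero)  n≢0 M = ⊥-elim (n≢0 refl)
  P≤ (+ suc _) _   M = 1*-bounded (P≤w M)
  P≤ -[1+ _ ]  _   M = 1*-bounded (P≤w M)

eval-do-isZero : ∀ {w N} k →
  (∀ M → eval isZero k (□ ∙ N [0:= M ]) ≤ w) → ∀ L →
  eval isZero k (□ ∙ Do L ⨾ if var here =0then N else Ω) ≤ eval isZero k (□ ∙ L) * w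
eval-do-isZero {w} {N} k N≤w L = ≤-trans (eval-suc 0≤isZero k _)
  (≤-trans (bounded isZero (λ n → isZero n * w) 0≤isZero k ((λ M → 1*-bounded (N≤w M)) , Ω≤) □ L)
    (≤-reflexive (eval-scale w isZero k _)))
  where
  open Test □ N Ω
  Ω≤ : ∀ n → n ≢ 0ℤ → ∀ (M : Ground int) → eval isZero k (□ ∙ Ω) ≤ isZero n * w
  Ω≤ (+ zero)  n≢0 M = ⊥-elim (n≢0 refl)
  Ω≤ (+ suc _) _   M = Ω-bounded k w
  Ω≤ -[1+ _ ]  _   M = Ω-bounded k w

module _ (P : Ground (D int ⇒ D int ⇒ D int)) where

  call₁ call₂ call₃ : Ground (D int)
  call₁ = P $ ret (con 1ℤ) $ ret (con 1ℤ)
  call₂ = P $ ret (con 0ℤ) $ Ω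
  call₃ = P $ Ω $ ret (con 0ℤ)

  module _ (k : ℕ) where

    prob₁ prob₂ prob₃ : ℚ
    prob₁ = eval nonZero k (□ ∙ call₁)
    prob₂ = eval isZero k (□ ∙ call₂)
    prob₃ = eval isZero k (□ ∙ call₃)

    0≤prob₁ : 0ℚ ≤ prob₁
    0≤prob₁ = 0≤eval 0≤nonZero k _

    0≤prob₂ : 0ℚ ≤ prob₂
    0≤prob₂ = 0≤eval 0≤isZero k _

    0≤prob₃ : 0ℚ ≤ prob₃
    0≤prob₃ = 0≤eval 0≤isZero k _

    -- `P` is closed, so weakening it to the scope `Args` and then instantiating gives back `P`; the
    -- three calls are instances of `P` applied to the two variables.
    prob₁+prob₂+prob₃≤2 : prob₁ + prob₂ + prob₃ ≤ 1ℚ + 1ℚ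
    prob₁+prob₂+prob₃≤2 = ≡.subst (_≤ 1ℚ + 1ℚ)
      (cong₂ _+_ (cong₂ _+_
        (cong (λ F → eval nonZero k (□ ∙ F $ ret (con 1ℤ) $ ret (con 1ℤ))) (closed θ₁))
        (cong (λ F → eval isZero k (□ ∙ F $ ret (con 0ℤ) $ Ω)) (closed θ₂)))
        (cong (λ F → eval isZero k (□ ∙ F $ Ω $ ret (con 0ℤ))) (closed θ₃)))
      (three-calls k □ (rename (λ ()) P $ var here $ var (there here)))
      where
      closed : ∀ (θ : Substitution Args []) → subst θ (rename (λ ()) P) ≡ P
      closed θ = ≡.trans (subst-rename θ (λ ()) P)
        (≡.trans (subst-cong (λ ()) P) (subst-var P))

    eval-portest : eval isZero k (□ ∙ portest $ P) ≤ prob₁ * (prob₂ * (prob₃ * 1ℚ))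
    -- Two transitions, `explore-$` and `β`, lead to the body of `portest`.
    eval-portest = ≤-trans (eval-+ 0≤isZero 2 k _)
      (eval-do-nonZero k (λ L → second (weaken-[0:=] P L) (inner L)) call₁)
      where
      -- In the third call `P` has been weakened under two binders; substituting the results `L` and
      -- `M` of the earlier calls undoes both weakenings.
      inner : ∀ (L M : Ground int) →
        subst (liftₛ (single L)) (rename there (rename there P)) [0:= M ] ≡ P
      inner L M = ≡.trans
        (cong (_[0:= M ]) (≡.trans (subst-rename (liftₛ (single L)) there (rename there P))
          (≡.trans (sym (rename-subst there (single L) (rename there P)))
            (cong (rename there) (weaken-[0:=] P L)))))
        (weaken-[0:=] P M)

      -- The copy of `P` left by the substitutions is abstracted as `F`, so that its equation with
      -- `P` can be matched by `refl`.
      third : ∀ {F} → F ≡ P →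
        eval isZero k (□ ∙ Do F $ Ω $ ret (con 0ℤ) ⨾ if var here =0then ret (con 0ℤ) else Ω)
          ≤ prob₃ * 1ℚ
      third refl = eval-do-isZero k
        (λ M → eval≤1 0≤isZero isZero≤1 k (□ ∙ ret (con 0ℤ))) call₃

      second : ∀ {F F′} → F ≡ P → (∀ (M : Ground int) → F′ [0:= M ] ≡ P) →
        eval isZero k (□ ∙ Do F $ ret (con 0ℤ) $ Ω ⨾ if var here =0then
          (Do F′ $ Ω $ ret (con 0ℤ) ⨾ if var here =0then ret (con 0ℤ) else Ω) else Ω)
          ≤ prob₂ * (prob₃ * 1ℚ)
      second refl F′≡P = eval-do-isZero k (λ M → third (F′≡P M)) call₂

-- The value attained by pmpor

-- A finite set of traces witnessing `w` as a lower bound for the probability of the answer 0.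
Attains : Config → ℚ → Set
Attains c w = ∃[ ts ] Unique ts × totalWeight {c = c} {d = ret□ ∙ con 0ℤ} ts ≡ w

attains-0 : ∀ {c} → Attains c 0ℚ
attains-0 = [] , [] , refl

attains-1 : Attains (ret□ ∙ con 0ℤ) 1ℚ
attains-1 = [] ∷ [] , [] ∷ [] , refl

∷-injectiveʳ : ∀ {Γ τ} {c c′ d : Configuration Γ τ} {α} {r : c ⟶[ α ] c′} {t u : Trace c′ d} →
  _≡_ {A = Trace c d} (r ∷ t) (r ∷ u) → t ≡ u
∷-injectiveʳ refl = refl

-- Lets deterministic stretches of a run be carried out by computation; it halts at a coin flip or
-- an answer.
advance : ℕ → Config → Config
advance zero    c = c
advance (suc k) c with transitions c
... | det {c′ = c′} _ _ = advance k c′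
... | _                 = c

attains-advance : ∀ k c {w} → Attains (advance k c) w → Attains c w
attains-advance zero    c a = a
attains-advance (suc k) c a with transitions c
... | answer _     = a
... | choice _ _ _ = a
... | det {c′ = c′} r _ with ts , unique , refl ← attains-advance k c′ a =
  map (r ∷_) ts , Unique.map⁺ ∷-injectiveʳ unique ,
  ≡.trans (totalWeight-map r ts) (*-identityˡ _)

attains-⊕ : ∀ {τ} {C : Context [] (D τ) (D int)} {M N w x} →
  Attains (C ∙ M) w → Attains (C ∙ N) x → Attains (C ∙ M ⊕ N) (mean w x)
attains-⊕ {C = C} {M} {N} (ts , uniqueˡ , refl) (us , uniqueʳ , refl) =
  map (⊕-left ∷_) ts ++ map (⊕-right ∷_) us ,
  Unique.++⁺ (Unique.map⁺ ∷-injectiveʳ uniqueˡ) (Unique.map⁺ ∷-injectiveʳ uniqueʳ)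
    disjoint ,
  ≡.trans (totalWeight-++ (map (⊕-left ∷_) ts) (map (⊕-right ∷_) us))
    (cong₂ _+_ (totalWeight-map ⊕-left ts) (totalWeight-map ⊕-right us))
  where
  disjoint : Disjoint (map (⊕-left {C = C} {M} {N} ∷_) ts) (map (⊕-right ∷_) us)
  disjoint (t∈ , t∈′) with ∈-map⁻ _ t∈ | ∈-map⁻ _ t∈′
  ... | _ , _ , refl | _ , _ , ()

-- The recursion to which `pmpor $ M $ N` reduces.
loop : Ground (D int) → Ground (D int) → Ground (D int)
loop M N = rec D (ƛ
  (((lror $ rename there M $ rename there N) ⊕ (rlor $ rename there M $ rename there N))
    ⊕ (ret (con 0ℤ) ⊕ var here)))

-- Among four branches of weight 1/4, two succeed, one fails and one repeats the loop; `n` counts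
-- the unfoldings.
loopProb : ℕ → ℚ
loopProb zero    = 0ℚ
loopProb (suc n) = ½ + ½ * (½ * loopProb n)

-- The condition on `x + y + z` treats the three calls uniformly: in each, two of the branches
-- `lror`, `rlor` and `ret (con 0ℤ)` continue with weight `w` and the third is counted as 0.
attains-loop : ∀ {C : Context [] (D int) (D int)} {M N w x y z} →
  Attains (C ∙ lror $ M $ N) x → Attains (C ∙ rlor $ M $ N) y →
  Attains (C ∙ ret (con 0ℤ)) z → x + y + z ≡ w + w →
  ∀ n → Attains (C ∙ loop M N) (loopProb n * w)
attains-loop {C} {w = w} _ _ _ _ zero = ≡.subst (Attains _) (sym (*-zeroˡ w)) attains-0
attains-loop {C} {M} {N} {w} {x} {y} {z} l r e sum (suc n) =
  -- Three transitions, `unfold`, `explore-$` and `β`, expose the outer coin flip.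
  attains-advance 3 _ (≡.subst₂ (λ M′ N′ → Attains
      (C ∙ ((lror $ M′ $ N′) ⊕ (rlor $ M′ $ N′)) ⊕ (ret (con 0ℤ) ⊕ loop M N))
      (loopProb (suc n) * w))
    (sym (weaken-[0:=] M (loop M N))) (sym (weaken-[0:=] N (loop M N)))
    (≡.subst (Attains _) weights
      (attains-⊕ (attains-⊕ l r) (attains-⊕ e (attains-loop l r e sum n)))))
  where
  open ≡.≡-Reasoning
  weights : mean (mean x y) (mean z (loopProb n * w)) ≡ loopProb (suc n) * w
  weights = begin
    mean (mean x y) (mean z (loopProb n * w))
      ≡⟨ solve 5 (λ x y z w u →
           con ½ :* (con ½ :* x :+ con ½ :* y) :+ con ½ :* (con ½ :* z :+ con ½ :* (u :* w)) :=
           con ½ :* (con ½ :* (x :+ y :+ z) :+ con ½ :* (u :* w))) refl x y z w (loopProb n) ⟩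
    ½ * (½ * (x + y + z) + ½ * (loopProb n * w))
      ≡⟨ cong (λ v → ½ * (½ * v + ½ * (loopProb n * w))) sum ⟩
    ½ * (½ * (w + w) + ½ * (loopProb n * w))
      ≡⟨ solve 2 (λ w u → con ½ :* (con ½ :* (w :+ w) :+ con ½ :* (u :* w)) :=
           (con ½ :+ con ½ :* (con ½ :* u)) :* w) refl w (loopProb n) ⟩
    loopProb (suc n) * w ∎

-- Here the branch returning 0 is the one discarded; in the next two lemmas it is the branch that
-- begins by evaluating `Ω`. Each retained `lror` or `rlor` branch reaches its constant in 10
-- transitions.
attains-loop₁ : ∀ {C w} n → Attains (C ∙ ret (con 1ℤ)) w →
  Attains (C ∙ loop (ret (con 1ℤ)) (ret (con 1ℤ))) (loopProb n * w)
attains-loop₁ {w = w} n a = attains-loop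
  (attains-advance 10 _ a) (attains-advance 10 _ a) attains-0 (+-identityʳ (w + w)) n

attains-loop₂ : ∀ {C w} n → Attains (C ∙ ret (con 0ℤ)) w →
  Attains (C ∙ loop (ret (con 0ℤ)) Ω) (loopProb n * w)
attains-loop₂ {w = w} n a = attains-loop
  (attains-advance 10 _ a) attains-0 a (cong (_+ w) (+-identityʳ w)) n

attains-loop₃ : ∀ {C w} n → Attains (C ∙ ret (con 0ℤ)) w →
  Attains (C ∙ loop Ω (ret (con 0ℤ))) (loopProb n * w)
attains-loop₃ {w = w} n a = attains-loop
  attains-0 (attains-advance 10 _ a) a (cong (_+ w) (+-identityˡ w)) n

-- There are 7 transitions to the first loop, 10 from the value of a loop
-- to the next loop, and 6 from the value of the last loop to the answer.
attains-portest-pmpor : ∀ n →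
  Attains (□ ∙ portest $ pmpor) (loopProb n * (loopProb n * (loopProb n * 1ℚ)))
attains-portest-pmpor n =
  attains-advance 7 _ (attains-loop₁ n
    (attains-advance 10 _ (attains-loop₂ n
      (attains-advance 10 _ (attains-loop₃ n
        (attains-advance 6 _ attains-1))))))

-- 2/3 is the fixed point of the recurrence, and each unfolding divides the distance to it by 4.
loopProb≡ : ∀ n → loopProb n ≡ + 2 / 3 * (1ℚ - ¼^ n)
loopProb≡ zero    = refl
loopProb≡ (suc n) = ≡.trans (cong (λ u → ½ + ½ * (½ * u)) (loopProb≡ n))
  (solve 1 (λ v → con ½ :+ con ½ :* (con ½ :* (con (+ 2 / 3) :* (con 1ℚ :- v))) :=
                  con (+ 2 / 3) :* (con 1ℚ :- con ½ :* (con ½ :* v))) refl (¼^ n))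

-- Expanding the cube of `2/3 (1 - v)` gives `8/27 - 8/9 v + 8/27 v² (3 - v)`, where `8/9 v ≤ v` and
-- the last term is nonnegative.
loopProb³-lower : ∀ n → + 8 / 27 - ¼^ n ≤ loopProb n * (loopProb n * (loopProb n * 1ℚ))
loopProb³-lower n = begin
  + 8 / 27 - v
    ≤⟨ p≤p+nonNeg (0≤+ (0≤* {+ 1 / 9} (nonNegative⁻¹ _) (0≤¼^ n))
         (0≤* {+ 8 / 27} (nonNegative⁻¹ _) (0≤* (0≤square v) (0≤+ {1ℚ + 1ℚ} (nonNegative⁻¹ _) 0≤1-v)))) ⟩
  + 8 / 27 - v + (+ 1 / 9 * v + + 8 / 27 * (v * v * (1ℚ + 1ℚ + (1ℚ - v))))
    ≡⟨ solve 1 (λ v → con (+ 8 / 27) :- v :+ (con (+ 1 / 9) :* v :+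
           con (+ 8 / 27) :* (v :* v :* (con (1ℚ + 1ℚ) :+ (con 1ℚ :- v)))) :=
         con (+ 2 / 3) :* (con 1ℚ :- v) :* (con (+ 2 / 3) :* (con 1ℚ :- v) :*
           (con (+ 2 / 3) :* (con 1ℚ :- v) :* con 1ℚ))) refl v ⟩
  + 2 / 3 * (1ℚ - v) * (+ 2 / 3 * (1ℚ - v) * (+ 2 / 3 * (1ℚ - v) * 1ℚ))
    ≡⟨ cong (λ u → u * (u * (u * 1ℚ))) (loopProb≡ n) ⟨
  loopProb n * (loopProb n * (loopProb n * 1ℚ)) ∎
  where
  open ≤-Reasoning
  v : ℚ
  v = ¼^ n
  0≤1-v : 0ℚ ≤ 1ℚ - v
  0≤1-v = p≤q⇒0≤q-p (¼^≤1 n)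

loopProb³-approaches : ∀ {q} → q < + 8 / 27 →
  ∃[ n ] q < loopProb n * (loopProb n * (loopProb n * 1ℚ))
loopProb³-approaches {q} q< = n , (begin-strict
    q                 ≡⟨ solve 2 (λ q e → q := e :- (e :- q)) refl q e ⟩
    e - (e - q)       <⟨ +-monoʳ-< e (neg-antimono-< v<ε) ⟩
    e - ¼^ n          ≤⟨ loopProb³-lower n ⟩
    loopProb n * (loopProb n * (loopProb n * 1ℚ)) ∎)
  where
  open ≤-Reasoning
  e : ℚ
  e = + 8 / 27
  vanishing : ∃[ n ] ¼^ n < e - q
  vanishing = ¼^-vanishes (p<q⇒0<q-p q<)
  n : ℕ
  n = proj₁ vanishing
  v<ε : ¼^ n < e - q
  v<ε = proj₂ vanishing

-- From step-bounded payoffs to probabilities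

steps-bound : ∀ {Γ τ} {c d : Configuration Γ τ} (ts : List (Trace c d)) →
  ∃[ k ] All (λ t → steps t ℕ.< k) ts
steps-bound []       = 0 , []
steps-bound (t ∷ ts) with k , short ← steps-bound ts =
  suc (steps t) ℕ.⊔ k ,
  ℕ.m≤m⊔n (suc (steps t)) k ∷
  All.map (λ t<k → ℕ.≤-trans t<k (ℕ.m≤n⊔m (suc (steps t)) k)) short

-- A rational below the probability lies below the weight of some finite list of traces; these share
-- one step budget `k`, at which the product bound applies.
Pr-portest≤ : (P : Ground (D int ⇒ D int ⇒ D int)) →
  Pr[ portest $ P ↓ 0ℤ ] ≤ᴸ ⌜ + 8 / 27 ⌝
Pr-portest≤ P (ts , unique , q<) with k , short ← steps-bound ts =
  <-≤-trans q< (≤-trans (totalWeight≤eval 0≤isZero refl k unique short)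
    (≤-trans (eval-portest P k)
      (product≤8/27 (0≤prob₁ P k) (0≤prob₂ P k) (0≤prob₃ P k) (prob₁+prob₂+prob₃≤2 P k))))

attains⇒<Pr : ∀ {c w q} → Attains c w → q < w → Pr⟨ c ↓ 0ℤ ⟩ q
attains⇒<Pr (ts , unique , refl) q<w = ts , unique , q<w

Pr-portest-pmpor≥ : ⌜ + 8 / 27 ⌝ ≤ᴸ Pr[ portest $ pmpor {Γ = []} ↓ 0ℤ ]
Pr-portest-pmpor≥ {q} q<8/27 = attains⇒<Pr (attains-portest-pmpor n) q<
  where
  approach : ∃[ n ] q < loopProb n * (loopProb n * (loopProb n * 1ℚ))
  approach = loopProb³-approaches q<8/27
  n : ℕ
  n = proj₁ approach
  q< : q < loopProb n * (loopProb n * (loopProb n * 1ℚ))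
  q< = proj₂ approach

theorem6p3 : ((P : Ground (D int ⇒ D int ⇒ D int)) →
    Pr[ portest $ P ↓ 0ℤ ] ≤ᴸ ⌜ + 8 / 27 ⌝)
    × Pr[ portest $ pmpor {Γ = []} ↓ 0ℤ ] ≡ᴸ ⌜ + 8 / 27 ⌝
theorem6p3 = Pr-portest≤ , Pr-portest≤ pmpor , Pr-portest-pmpor≥
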